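{- Let $q>0$ be transcendental, or $q\ge4$. Then for every real number $a$ there is at most one proper path $\mathbf m$ for $q$ with $c(q,\mathbf m)=a$. In particular, the weight $w_q$ is unique.
   Context: Let $q>0$. For an integer $k\ge0$ and $\mathbf m=(m_0,\dots,m_k)\in\mathbb Z^{k+1}$ put $\mathbf m_j=(m_0,\dots,m_j)$, $0\le j\le k$. Define $c(q,\mathbf m_0)=m_0$ and recursively $c(q,\mathbf m_j)=m_j+\frac{1}{q\,c(q,\mathbf m_{j-1})}$ for $1\le j\le k$, so that $c(q,\mathbf m)=m_k+\cfrac{1}{qm_{k-1}+\cfrac{q}{\ddots+\cfrac{q}{qm_0}}}$. The vector $\mathbf m$ is a path for $q$ (of length $k$) if $c(q,\mathbf m_j)\ne0$ for $0\le j\le k-1$ (all denominators nonzero). A path is proper if $m_j\ne0$ for all $0\le j\le k-1$. The weight of a path is $w_q(\mathbf m)=q^{k/2}\prod_{j=0}^{k-1}|c(q,\mathbf m_j)|$ (and $w_q(\mathbf m)=1$ if $k=0$). The weight $w_q$ is called unique if $w_q(\mathbf m)=w_q(\mathbf n)$ for all paths $\mathbf m,\mathbf n$ for $q$ with $c(q,\mathbf m)=c(q,\mathbf n)$. -}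

module Defs where

open import Algebra.Apartness.Bundles using (HeytingField; HeytingCommutativeRing)
import Algebra.Apartness.Properties.HeytingCommutativeRing as HeytingProperties
open import Algebra.Bundles using (CommutativeRing; CommutativeSemiring)
import Algebra.Properties.Ring as RingProperties
import Algebra.Properties.Semiring.Exp as SemiringExp
import Algebra.Properties.Semiring.Mult as SemiringMult
import Algebra.Solver.Ring.NaturalCoefficients.Default as NatSolver
open import Data.Integer.Base using (ℤ; +_; -[1+_]; 0ℤ)
open import Data.List.Base using (List; []; _∷_)
open import Data.List.Relation.Unary.Any using (Any)
open import Data.Nat.Base using (ℕ; zero; suc)
open import Data.Product.Base using (Σ; ∃; ∃-syntax; _×_; _,_; proj₁; proj₂)
open import Data.Sum.Base using (_⊎_; inj₁; inj₂)
open import Data.Unit.Base using (⊤)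
open import Data.Vec.Base using (Vec; init; last)
open import Data.Vec.Relation.Unary.All using (All)
import Level
open import Relation.Binary.Core using (Rel)
open import Relation.Binary.Definitions using (Cotransitive)
open import Relation.Binary.PropositionalEquality.Core using (_≢_)
import Relation.Binary.Reasoning.Setoid as SetoidReasoning
open import Relation.Binary.Structures using (IsStrictPartialOrder)
open import Relation.Nullary.Negation.Core using (¬_; contradiction)
open import Relation.Unary using (Pred)

-- The real numbers, axiomatised as an ordered field with the least upper
-- bound property.  Constructively the latter is restricted to located sets;
-- classically every set is located, x # y means x ≉ y, and a model is exactly
-- a Dedekind-complete ordered field, so ℝ up to unique isomorphism (the
-- Archimedean property follows).

record RealNumbers a ℓ : Set (Level.suc (a Level.⊔ ℓ)) where

  infix 4 _<_ _≤_

  field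
    heytingField : HeytingField a ℓ ℓ

  open HeytingField heytingField public

  field
    _<_                  : Rel Carrier ℓ
    isStrictPartialOrder : IsStrictPartialOrder _≈_ _<_
    #⇒<⊎>                : ∀ {x y} → x # y → x < y ⊎ y < x
    <⇒#                  : ∀ {x y} → x < y → x # y
    +-monoʳ-<            : ∀ z {x y} → x < y → z + x < z + y
    *-pos                : ∀ {x y} → 0# < x → 0# < y → 0# < x * y

  _≤_ : Rel Carrier ℓ
  x ≤ y = ¬ (y < x)

  UpperBound : Pred Carrier ℓ → Pred Carrier (a Level.⊔ ℓ)
  UpperBound S b = ∀ x → S x → x ≤ b

  Located : Pred Carrier ℓ → Set (a Level.⊔ ℓ)
  Located S = ∀ {u v} → u < v → (∃[ x ] S x × u < x) ⊎ UpperBound S v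

  IsLub : Pred Carrier ℓ → Pred Carrier (a Level.⊔ ℓ)
  IsLub S s = UpperBound S s × (∀ {u} → u < s → ∃[ x ] S x × u < x)

  field
    complete : (S : Pred Carrier ℓ) → ∃ S → ∃ (UpperBound S) → Located S →
               ∃ (IsLub S)

module Identities {a ℓ} (R : CommutativeSemiring a ℓ) where

  open CommutativeSemiring R
  open NatSolver R using (solve; _:=_; _:+_; _:*_; con)

  1+x-square : ∀ x → x + (1# + (x + x * x)) ≈ (1# + x) * (1# + x)
  1+x-square = solve 1 (λ x → x :+ (con 1 :+ (x :+ x :* x))
                     := (con 1 :+ x) :* (con 1 :+ x)) refl

  +-square : ∀ s e → s * s + ((s + s) * e + e * e) ≈ (s + e) * (s + e)
  +-square = solve 2 (λ s e → s :* s :+ ((s :+ s) :* e :+ e :* e)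
                         := (s :+ e) :* (s :+ e)) refl

  e+y-square : ∀ e y → (e + y) * (e + y) + e * e ≈ ((e + y) + (e + y)) * e + y * y
  e+y-square = solve 2 (λ e y → (e :+ y) :* (e :+ y) :+ e :* e
                      := ((e :+ y) :+ (e :+ y)) :* e :+ y :* y) refl

module RealProperties {a ℓ} (ℝ : RealNumbers a ℓ) where

  open RealNumbers ℝ
  open HeytingProperties heytingCommutativeRing public
    using (x-0≈x; x#0y#0→xy#0)

  open HeytingCommutativeRing heytingCommutativeRing public
    using (commutativeRing)
  open CommutativeRing commutativeRing using (ring; semiring; commutativeSemiring)
  open RingProperties ring
    using (-‿distribˡ-*; -‿distribʳ-*; -‿involutive)
  open IsStrictPartialOrder isStrictPartialOrder public
    using (<-respʳ-≈; <-respˡ-≈)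
    renaming (trans to <-trans; irrefl to <-irrefl)
  open Identities commutativeSemiring

  open SemiringExp semiring public using (_^_)
  open SemiringMult semiring public using () renaming (_×_ to _·_)

  fromℤ : ℤ → Carrier
  fromℤ (+ n)    = n · 1#
  fromℤ -[1+ n ] = - (suc n · 1#)

  <-cotrans : Cotransitive _<_
  <-cotrans x<y z with #-cotrans (<⇒# x<y) z
  ... | inj₁ x#z with #⇒<⊎> x#z
  ...   | inj₁ x<z = inj₁ x<z
  ...   | inj₂ z<x = inj₂ (<-trans z<x x<y)
  <-cotrans x<y z | inj₂ z#y with #⇒<⊎> z#y
  ...   | inj₁ z<y = inj₂ z<y
  ...   | inj₂ y<z = inj₁ (<-trans x<y y<z)

  <-asym : ∀ {x y} → x < y → ¬ (y < x)
  <-asym x<y y<x = <-irrefl refl (<-trans x<y y<x)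

  ≤-<-trans : ∀ {x y z} → x ≤ y → y < z → x < z
  ≤-<-trans {x} x≤y y<z with <-cotrans y<z x
  ... | inj₁ y<x = contradiction y<x x≤y
  ... | inj₂ x<z = x<z

  ≤-antisym : ∀ {x y} → x ≤ y → y ≤ x → x ≈ y
  ≤-antisym {x} {y} x≤y y≤x = proj₁ (tight x y) λ x#y → helper (#⇒<⊎> x#y)
    where
    helper : ¬ (x < y ⊎ y < x)
    helper (inj₁ x<y) = y≤x x<y
    helper (inj₂ y<x) = x≤y y<x

  <-resp : ∀ {x x′ y y′} → x ≈ x′ → y ≈ y′ → x < y → x′ < y′
  <-resp x≈x′ y≈y′ x<y = <-respˡ-≈ x≈x′ (<-respʳ-≈ y≈y′ x<y)

  +-monoˡ-< : ∀ z {x y} → x < y → x + z < y + z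
  +-monoˡ-< z x<y = <-resp (+-comm z _) (+-comm z _) (+-monoʳ-< z x<y)

  x<x+y : ∀ {x y} → 0# < y → x < x + y
  x<x+y {x} 0<y = <-respˡ-≈ (+-identityʳ x) (+-monoʳ-< x 0<y)

  +-pos : ∀ {x y} → 0# < x → 0# < y → 0# < x + y
  +-pos 0<x 0<y = <-trans 0<x (x<x+y 0<y)

  x+[y-x]≈y : ∀ x y → x + (y - x) ≈ y
  x+[y-x]≈y x y = trans (+-comm x (y - x))
    (trans (+-assoc y (- x) x) (trans (+-congˡ (-‿inverseˡ x)) (+-identityʳ y)))

  x<y⇒0<y-x : ∀ {x y} → x < y → 0# < y - x
  x<y⇒0<y-x {x} x<y = <-respˡ-≈ (-‿inverseʳ x) (+-monoˡ-< (- x) x<y)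

  x<0⇒0<-x : ∀ {x} → x < 0# → 0# < - x
  x<0⇒0<-x {x} x<0 = <-respʳ-≈ (+-identityˡ (- x)) (x<y⇒0<y-x x<0)

  *-monoʳ-< : ∀ {z} → 0# < z → ∀ {x y} → x < y → z * x < z * y
  *-monoʳ-< {z} 0<z {x} {y} x<y =
    <-respʳ-≈ (trans (sym (distribˡ z x (y - x))) (*-congˡ (x+[y-x]≈y x y)))
              (x<x+y (*-pos 0<z (x<y⇒0<y-x x<y)))

  *-monoˡ-< : ∀ {z} → 0# < z → ∀ {x y} → x < y → x * z < y * z
  *-monoˡ-< 0<z x<y = <-resp (*-comm _ _) (*-comm _ _) (*-monoʳ-< 0<z x<y)

  square-mono : ∀ {x y} → 0# < x → x < y → x * x < y * y
  square-mono 0<x x<y =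
    <-trans (*-monoʳ-< 0<x x<y) (*-monoˡ-< (<-trans 0<x x<y) x<y)

  -x*-x≈x*x : ∀ x → (- x) * (- x) ≈ x * x
  -x*-x≈x*x x = trans (sym (-‿distribˡ-* x (- x)))
    (trans (-‿cong (sym (-‿distribʳ-* x x))) (-‿involutive (x * x)))

  0<1 : 0# < 1#
  0<1 with #⇒<⊎> (HeytingProperties.1#0 heytingCommutativeRing)
  ... | inj₂ 0<1 = 0<1
  ... | inj₁ 1<0 = <-respʳ-≈ (trans (-x*-x≈x*x 1#) (*-identityˡ 1#))
                     (*-pos (x<0⇒0<-x 1<0) (x<0⇒0<-x 1<0))

  0<x⇒x#0 : ∀ {x} → 0# < x → x # 0#
  0<x⇒x#0 0<x = #-sym (<⇒# 0<x)

  1/ : ∀ x → x # 0# → Carrier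
  1/ x x#0 = proj₁ (#⇒invertible x#0)

  x*1/x≈1 : ∀ x (x#0 : x # 0#) → x * 1/ x x#0 ≈ 1#
  x*1/x≈1 x x#0 =
    trans (*-congʳ (sym (x-0≈x x))) (proj₂ (proj₂ (#⇒invertible x#0)))

  1/-pos : ∀ {x} (0<x : 0# < x) → 0# < 1/ x (0<x⇒x#0 0<x)
  1/-pos {x} 0<x = helper (<-cotrans 0<1 (x * (y * y)))
    where
    y = 1/ x (0<x⇒x#0 0<x)
    xy≈1 : x * y ≈ 1#
    xy≈1 = x*1/x≈1 x _
    xyy≈y : x * (y * y) ≈ y
    xyy≈y = trans (sym (*-assoc x y y)) (trans (*-congʳ xy≈1) (*-identityˡ y))
    helper : 0# < x * (y * y) ⊎ x * (y * y) < 1# → 0# < y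
    helper (inj₁ 0<xyy) = <-respʳ-≈ xyy≈y 0<xyy
    helper (inj₂ _) with #⇒<⊎> y#0
      where
      y#0 : y # 0#
      y#0 = HeytingProperties.invertibleˡ⇒# heytingCommutativeRing
        (x , trans (*-congˡ (x-0≈x y)) xy≈1)
    ... | inj₂ 0<y = 0<y
    ... | inj₁ y<0 = contradiction
      (<-respʳ-≈ xyy≈y (*-pos 0<x
        (<-respʳ-≈ (-x*-x≈x*x y) (*-pos (x<0⇒0<-x y<0) (x<0⇒0<-x y<0)))))
      (<-asym y<0)

  *-cancelˡ-< : ∀ {z} → 0# < z → ∀ {x y} → z * x < z * y → x < y
  *-cancelˡ-< {z} 0<z zx<zy =
    <-resp (cancel _) (cancel _) (*-monoʳ-< (1/-pos 0<z) zx<zy)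
    where
    cancel : ∀ x → 1/ z (0<x⇒x#0 0<z) * (z * x) ≈ x
    cancel x = trans (sym (*-assoc _ z x))
      (trans (*-congʳ (trans (*-comm _ z) (x*1/x≈1 z _))) (*-identityˡ x))

  module _ (x y : Carrier) where

    private
      Pair : Pred Carrier ℓ
      Pair z = z ≈ x ⊎ z ≈ y

      bound : ∀ {b} → x < b → y < b → UpperBound Pair b
      bound x<b y<b z (inj₁ z≈x) b<z = <-asym x<b (<-respʳ-≈ z≈x b<z)
      bound x<b y<b z (inj₂ z≈y) b<z = <-asym y<b (<-respʳ-≈ z≈y b<z)

      bounded : ∃ (UpperBound Pair)
      bounded with <-cotrans (x<x+y {x} 0<1) y
      ... | inj₁ x<y   = y + 1# , bound (<-trans x<y (x<x+y 0<1)) (x<x+y 0<1)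
      ... | inj₂ y<x+1 = x + 1# , bound (x<x+y 0<1) y<x+1

      located : Located Pair
      located u<v with <-cotrans u<v x | <-cotrans u<v y
      ... | inj₁ u<x | _        = inj₁ (x , inj₁ refl , u<x)
      ... | inj₂ _   | inj₁ u<y = inj₁ (y , inj₂ refl , u<y)
      ... | inj₂ x<v | inj₂ y<v = inj₂ (bound x<v y<v)

      max : ∃ (IsLub Pair)
      max = complete Pair (x , inj₁ refl) bounded located

    _⊔_ : Carrier
    _⊔_ = proj₁ max

    x≤x⊔y : x ≤ _⊔_
    x≤x⊔y = proj₁ (proj₂ max) x (inj₁ refl)

    y≤x⊔y : y ≤ _⊔_
    y≤x⊔y = proj₁ (proj₂ max) y (inj₂ refl)

    ⊔-lub : ∀ {z} → x ≤ z → y ≤ z → _⊔_ ≤ z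
    ⊔-lub x≤z y≤z z<max with proj₂ (proj₂ max) z<max
    ... | w , inj₁ w≈x , z<w = x≤z (<-respʳ-≈ w≈x z<w)
    ... | w , inj₂ w≈y , z<w = y≤z (<-respʳ-≈ w≈y z<w)

  ∣_∣ : Carrier → Carrier
  ∣ x ∣ = x ⊔ (- x)

  small : ∀ {k d} → 0# < k → 0# < d →
          ∃[ e ] 0# < e × e < 1# × k * e < d
  small {k} {d} 0<k 0<d = e , 0<e , e<1 , ke<d
    where
    open SetoidReasoning setoid
    t = k + d
    0<t : 0# < t
    0<t = +-pos 0<k 0<d
    e = d * 1/ t (0<x⇒x#0 0<t)
    0<e : 0# < e
    0<e = *-pos 0<d (1/-pos 0<t)
    e<1 : e < 1#
    e<1 = <-respʳ-≈ (x*1/x≈1 t _)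
      (*-monoˡ-< (1/-pos 0<t) (<-respʳ-≈ (+-comm d k) (x<x+y 0<k)))
    ke+de≈d : k * e + d * e ≈ d
    ke+de≈d = begin
      k * e + d * e              ≈⟨ distribʳ e k d ⟨
      t * (d * 1/ t _)           ≈⟨ *-congˡ (*-comm d _) ⟩
      t * (1/ t _ * d)           ≈⟨ *-assoc t _ d ⟨
      t * 1/ t _ * d             ≈⟨ *-congʳ (x*1/x≈1 t _) ⟩
      1# * d                     ≈⟨ *-identityˡ d ⟩
      d                          ∎
    ke<d : k * e < d
    ke<d = <-respʳ-≈ ke+de≈d (x<x+y (*-pos 0<d 0<e))

  module _ (q : Carrier) (0<q : 0# < q) where

    private
      Below : Pred Carrier ℓ
      Below x = x * x < q

      0∈Below : Below 0#
      0∈Below = <-respˡ-≈ (sym (zeroˡ 0#)) 0<q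

      bound : ∀ {b} → 0# < b → q < b * b → UpperBound Below b
      bound 0<b q<bb x xx<q b<x =
        <-asym (<-trans (square-mono 0<b b<x) xx<q) q<bb

      q<[1+q]² : q < (1# + q) * (1# + q)
      q<[1+q]² = <-respʳ-≈
        (1+x-square q)
        (x<x+y (+-pos 0<1 (+-pos 0<q (*-pos 0<q 0<q))))

      located : Located Below
      located {u} {v} u<v with small 0<1 (x<y⇒0<y-x u<v)
      ... | e , 0<e , _ , 1e<v-u = helper (<-cotrans u<u+e 0#)
        where
        u<u+e : u < u + e
        u<u+e = x<x+y 0<e
        u+e<v : u + e < v
        u+e<v = <-respʳ-≈ (x+[y-x]≈y u v)
          (+-monoʳ-< u (<-respˡ-≈ (*-identityˡ e) 1e<v-u))
        helper : u < 0# ⊎ 0# < u + e →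
                 (∃[ x ] Below x × u < x) ⊎ UpperBound Below v
        helper (inj₁ u<0)   = inj₁ (0# , 0∈Below , u<0)
        helper (inj₂ 0<u+e) with <-cotrans (square-mono 0<u+e u+e<v) q
        ... | inj₁ <q   = inj₁ (u + e , <q , u<u+e)
        ... | inj₂ q<vv = inj₂ (bound (<-trans 0<u+e u+e<v) q<vv)

      root : ∃ (IsLub Below)
      root = complete Below (0# , 0∈Below)
        (1# + q , bound (+-pos 0<1 0<q) q<[1+q]²) located

      module Lub {s : Carrier} (upper : UpperBound Below s)
                 (approx : ∀ {u} → u < s → ∃[ x ] Below x × u < x) where

        s-pos : 0# < s
        s-pos with small 0<1 0<q
        ... | e , 0<e , e<1 , 1e<q with <-cotrans 0<e s
        ...   | inj₁ 0<s = 0<s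
        ...   | inj₂ s<e = contradiction s<e
          (upper e (<-trans (*-monoˡ-< 0<e e<1) 1e<q))

        s*s≈q : s * s ≈ q
        s*s≈q = ≤-antisym ss≤q q≤ss
          where
          0<2s : 0# < s + s
          0<2s = +-pos s-pos s-pos

          q≤ss : q ≤ s * s
          q≤ss ss<q = contra (small (+-pos 0<2s 0<1) (x<y⇒0<y-x ss<q))
            where
            contra : ¬ (∃[ e ] 0# < e × e < 1# × (s + s + 1#) * e < q - s * s)
            contra (e , 0<e , e<1 , ke<d) =
              upper (s + e) (<-trans lt₁ lt₂) (x<x+y 0<e)
              where
              lt₁ : (s + e) * (s + e) < s * s + (s + s + 1#) * e
              lt₁ = <-resp
                (+-square s e)
                (+-congˡ (sym (distribʳ e (s + s) 1#)))
                (+-monoʳ-< (s * s) (+-monoʳ-< ((s + s) * e) (*-monoˡ-< 0<e e<1)))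
              lt₂ : s * s + (s + s + 1#) * e < q
              lt₂ = <-respʳ-≈ (x+[y-x]≈y (s * s) q) (+-monoʳ-< (s * s) ke<d)

          ss≤q : s * s ≤ q
          ss≤q q<ss = contra (small 0<2s (x<y⇒0<y-x q<ss))
            where
            contra : ¬ (∃[ e ] 0# < e × e < 1# × (s + s) * e < s * s - q)
            contra (e , 0<e , e<1 , ke<d) = helper (approx y<s)
              where
              y = s - e
              e+y≈s : e + y ≈ s
              e+y≈s = x+[y-x]≈y e s
              q+ke<ss : q + (s + s) * e < s * s
              q+ke<ss = <-respʳ-≈ (x+[y-x]≈y q (s * s)) (+-monoʳ-< q ke<d)
              e<s : e < s
              e<s = *-cancelˡ-< 0<2s
                (<-trans (<-respʳ-≈ (+-comm _ q) (x<x+y 0<q))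
                (<-trans q+ke<ss (<-respʳ-≈ (sym (distribʳ s s s))
                  (x<x+y (*-pos s-pos s-pos)))))
              0<y : 0# < y
              0<y = x<y⇒0<y-x e<s
              y<s : y < s
              y<s = <-respʳ-≈ (trans (+-comm y e) e+y≈s) (x<x+y 0<e)
              ss+ee≈ke+yy : s * s + e * e ≈ (s + s) * e + y * y
              ss+ee≈ke+yy = trans (+-congʳ (*-cong (sym e+y≈s) (sym e+y≈s)))
                (trans (e+y-square e y)
                  (+-congʳ (*-congʳ (+-cong e+y≈s e+y≈s))))
              helper : ¬ (∃[ x ] Below x × y < x)
              helper (x , xx<q , y<x) = <-irrefl refl
                (<-trans (<-trans (+-monoˡ-< k xx<q) q+ke<ss)
                (<-trans (x<x+y (*-pos 0<e 0<e))
                (<-respˡ-≈ (sym ss+ee≈ke+yy)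
                  (<-respʳ-≈ (+-comm k (x * x))
                    (+-monoʳ-< k (square-mono 0<y y<x))))))
                where k = (s + s) * e

    √ : Carrier
    √ = proj₁ root

    √-pos : 0# < √
    √-pos = Lub.s-pos (proj₁ (proj₂ root)) (proj₂ (proj₂ root))

    √*√≈q : √ * √ ≈ q
    √*√≈q = Lub.s*s≈q (proj₁ (proj₂ root)) (proj₂ (proj₂ root))

  -- Horner evaluation of an integer polynomial, constant coefficient first.
  eval : List ℤ → Carrier → Carrier
  eval []      x = 0#
  eval (c ∷ p) x = fromℤ c + x * eval p x

  Algebraic : Pred Carrier ℓ
  Algebraic x = ∃[ p ] Any (_≢ 0ℤ) p × eval p x ≈ 0#

  Transcendental : Pred Carrier ℓ
  Transcendental x = ¬ Algebraic x

-- A vector (m₀ , … , mₖ) is a Vec ℤ (suc k); its truncation (m₀ , … , mₖ₋₁)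
-- is its init, so unfolding init runs through the values at all prefixes.
-- Nonvanishing of denominators is stated with # because that is what makes
-- them invertible; the value is independent of the witness up to ≈.

module Paths {a ℓ} (ℝ : RealNumbers a ℓ)
             (q : RealNumbers.Carrier ℝ)
             (0<q : RealNumbers._<_ ℝ (RealNumbers.0# ℝ) q) where

  open RealNumbers ℝ
  open RealProperties ℝ

  mutual

    IsPath : ∀ {k} → Vec ℤ (suc k) → Set ℓ
    IsPath {zero}  m = Level.Lift ℓ ⊤
    IsPath {suc k} m = Σ (IsPath (init m)) λ path → c (init m) path # 0#

    c : ∀ {k} (m : Vec ℤ (suc k)) → IsPath m → Carrier
    c {zero}  m _            = fromℤ (last m)
    c {suc k} m (path , c#0) = fromℤ (last m) +
      1/ (q * c (init m) path) (x#0y#0→xy#0 (0<x⇒x#0 0<q) c#0)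

  Proper : ∀ {k} → Vec ℤ (suc k) → Set
  Proper m = All (_≢ 0ℤ) (init m)

  ∏∣c∣ : ∀ {k} (m : Vec ℤ (suc k)) → IsPath m → Carrier
  ∏∣c∣ {zero}  m _          = 1#
  ∏∣c∣ {suc k} m (path , _) = ∏∣c∣ (init m) path * ∣ c (init m) path ∣

  w : ∀ {k} (m : Vec ℤ (suc k)) → IsPath m → Carrier
  w {k} m path = (√ q 0<q ^ k) * ∏∣c∣ m path

  UniqueWeight : Set ℓ
  UniqueWeight = ∀ {k l} (m : Vec ℤ (suc k)) (n : Vec ℤ (suc l))
    (path-m : IsPath m) (path-n : IsPath n) →
    c m path-m ≈ c n path-n → w m path-m ≈ w n path-n

{-# OPTIONS --safe #-}

-- Suppose first q ≥ 4.  If m is proper then |1/(q c(q,m_{k-1}))| < 1/2,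
-- because |c(q,m_j)| > 1/2 propagates along j < k: its integer part has modulus
-- at least 1 and the rest is below 1/2.  Hence a = c(q,m) determines m_k as an
-- integer at distance < 1/2, and then determines c(q,m_{k-1}); descend.
-- If q is transcendental, c(q,m) = c(q,n) is a polynomial identity in q over ℤ,
-- so it persists at q = 4, where the first case applies.
-- For the weight, a zero entry m_j with 0 < j < k can be removed by replacing
-- m_{j-1}, 0, m_{j+1} with m_{j-1} + m_{j+1}; the two factors lost from the
-- weight satisfy q |c_{j-1} c_j| = 1.  So every path has a proper path of the
-- same value and weight.

module Submission where

open import Defs
open import Algebra.Bundles using (CommutativeRing)
import Algebra.Apartness.Properties.HeytingCommutativeRing as HeytingProperties
import Algebra.Properties.AbelianGroup as AbelianGroupProperties
import Algebra.Properties.Ring as RingProperties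
import Algebra.Properties.Semiring.Mult as SemiringMult
import Algebra.Solver.Ring as RingSolver
open import Algebra.Solver.Ring.AlmostCommutativeRing
  using (fromCommutativeRing; _-Raw-AlmostCommutative⟶_)
open import Data.Integer.Base as ℤ using (ℤ; +_; -[1+_]; 0ℤ; 1ℤ; -1ℤ; _⊖_)
import Data.Integer.Properties as ℤ
open import Data.List.Base using (List; []; _∷_)
open import Data.List.Relation.Unary.Any using (Any; any?; here; there)
open import Data.Maybe.Base as Maybe using (Maybe)
open import Data.Nat.Base as ℕ using (ℕ; zero; suc)
import Data.Nat.Properties as ℕ
open import Data.Product.Base using (∃; ∃-syntax; _×_; _,_; proj₁; proj₂)
open import Data.Sum.Base using (_⊎_; inj₁; inj₂; [_,_]′)
open import Data.Vec.Base using (Vec; []; _∷_; _∷ʳ_; init; last; initLast)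
open import Data.Vec.Properties using (init-∷ʳ; last-∷ʳ)
open import Data.Vec.Relation.Unary.All using (All; []; _∷_)
open import Function.Base using (_∘_)
open import Level using (Level)
open import Relation.Binary.PropositionalEquality.Core as ≡ using (_≡_; _≢_; cong; cong₂)
import Relation.Binary.Reasoning.Setoid as SetoidReasoning
open import Relation.Nullary.Decidable using (Dec; yes; no; ¬?; dec⇒maybe; decidable-stable)
open import Relation.Nullary.Negation.Core using (¬_; contradiction)
open import Relation.Unary using (Pred)

-- Vectors split into initial segment and last entry.

module _ {a p : Level} {A : Set a} {P : Pred A p} where

  All-empty : (xs : Vec A 0) → All P xs
  All-empty [] = []

  All-init : ∀ {n} (xs : Vec A (suc n)) → All P xs → All P (init xs)
  All-init (x ∷ [])     _          = []
  All-init (x ∷ y ∷ xs) (px ∷ pxs) = px ∷ All-init (y ∷ xs) pxs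

  All-last : ∀ {n} (xs : Vec A (suc n)) → All P xs → P (last xs)
  All-last (x ∷ [])     (px ∷ _)  = px
  All-last (x ∷ y ∷ xs) (_ ∷ pxs) = All-last (y ∷ xs) pxs

  All-init-last : ∀ {n} (xs : Vec A (suc n)) → All P (init xs) → P (last xs) → All P xs
  All-init-last (x ∷ [])     _          p = p ∷ []
  All-init-last (x ∷ y ∷ xs) (px ∷ pxs) p = px ∷ All-init-last (y ∷ xs) pxs p

module _ {a : Level} {A : Set a} where

  -- Lengths are packed with the vectors, so that vectors not yet known to be equally long can be
  -- compared; each is rebuilt from its `init` and `last`.
  initLast-injective : ∀ {k l} {m : Vec A (suc k)} {n : Vec A (suc l)} →
    _≡_ {A = ∃ (Vec A)} (k , init m) (l , init n) → last m ≡ last n →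
    _≡_ {A = ∃ λ j → Vec A (suc j)} (k , m) (l , n)
  initLast-injective {k} {l} {m} {n} eq-init eq-last =
    ≡.trans (cong (k ,_) (proj₂ (proj₂ (initLast m))))
      (≡.trans (cong₂ (λ u x → proj₁ u , proj₂ u ∷ʳ x) eq-init eq-last)
        (≡.sym (cong (l ,_) (proj₂ (proj₂ (initLast n))))))

  -- For a variable `xs`, `init (xs ∷ʳ x)` equals `xs` only propositionally, so both equations
  -- travel with the vector for later matching against `refl`.
  snoc : ∀ {n} (xs : Vec A n) (x : A) →
         ∃ λ (ys : Vec A (suc n)) → init ys ≡ xs × last ys ≡ x
  snoc xs x = xs ∷ʳ x , init-∷ʳ x xs , last-∷ʳ x xs

-- The ring homomorphism from the integers to the reals.

module IntegerEmbedding {a ℓ} (ℝ : RealNumbers a ℓ) where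

  open RealNumbers ℝ
  open RealProperties ℝ
  open CommutativeRing commutativeRing using (ring; semiring; +-abelianGroup)
  open RingProperties ring
    using (-0#≈0#; -‿involutive; -‿distribˡ-*; -‿distribʳ-*)
  open AbelianGroupProperties +-abelianGroup using (⁻¹-∙-comm)
  open SemiringMult semiring using (×-homo-+; ×1-homo-*; ×-congˡ)
  open SetoidReasoning setoid

  fromℤ-neg : ∀ i → fromℤ (ℤ.- i) ≈ - fromℤ i
  fromℤ-neg (+ zero)  = sym -0#≈0#
  fromℤ-neg (+ suc n) = refl
  fromℤ-neg -[1+ n ]  = sym (-‿involutive _)

  fromℤ-⊖ : ∀ m n → fromℤ (m ⊖ n) ≈ m · 1# - n · 1#
  fromℤ-⊖ zero    zero    = sym (-‿inverseʳ 0#)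
  fromℤ-⊖ zero    (suc n) = sym (+-identityˡ _)
  fromℤ-⊖ (suc m) zero    = sym (x-0≈x _)
  fromℤ-⊖ (suc m) (suc n) = begin
    fromℤ (suc m ⊖ suc n)                   ≡⟨ cong fromℤ (ℤ.[1+m]⊖[1+n]≡m⊖n m n) ⟩
    fromℤ (m ⊖ n)                           ≈⟨ fromℤ-⊖ m n ⟩
    m · 1# - n · 1#                         ≈⟨ +-identityʳ _ ⟨
    -- Zero is inserted as 1 - 1, so that one unit can join each multiple.
    m · 1# - n · 1# + 0#                    ≈⟨ +-congˡ (-‿inverseʳ 1#) ⟨
    m · 1# - n · 1# + (1# - 1#)             ≈⟨ +-comm _ _ ⟩
    1# - 1# + (m · 1# - n · 1#)             ≈⟨ +-assoc _ _ _ ⟩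
    1# + (- 1# + (m · 1# - n · 1#))         ≈⟨ +-congˡ (+-assoc _ _ _) ⟨
    1# + (- 1# + m · 1# - n · 1#)           ≈⟨ +-congˡ (+-congʳ (+-comm _ _)) ⟩
    1# + (m · 1# - 1# - n · 1#)             ≈⟨ +-congˡ (+-assoc _ _ _) ⟩
    1# + (m · 1# + (- 1# - n · 1#))         ≈⟨ +-assoc _ _ _ ⟨
    suc m · 1# + (- 1# - n · 1#)            ≈⟨ +-congˡ (⁻¹-∙-comm _ _) ⟩
    suc m · 1# - suc n · 1#                 ∎

  fromℤ-+ : ∀ i j → fromℤ (i ℤ.+ j) ≈ fromℤ i + fromℤ j
  fromℤ-+ (+ m)    (+ n)    = ×-homo-+ 1# m n
  fromℤ-+ (+ m)    -[1+ n ] = fromℤ-⊖ m (suc n)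
  fromℤ-+ -[1+ m ] (+ n)    = trans (fromℤ-⊖ n (suc m)) (+-comm _ _)
  fromℤ-+ -[1+ m ] -[1+ n ] = begin
    - (suc (suc (m ℕ.+ n)) · 1#)      ≈⟨ -‿cong (×-congˡ (ℕ.+-suc (suc m) n)) ⟨
    - ((suc m ℕ.+ suc n) · 1#)        ≈⟨ -‿cong (×-homo-+ 1# (suc m) (suc n)) ⟩
    - (suc m · 1# + suc n · 1#)       ≈⟨ ⁻¹-∙-comm _ _ ⟨
    - (suc m · 1#) + - (suc n · 1#)   ∎

  private
    fromℤ-pos-* : ∀ m j → fromℤ (+ m ℤ.* j) ≈ m · 1# * fromℤ j
    fromℤ-pos-* m (+ n) = begin
      fromℤ (+ m ℤ.* + n)     ≡⟨ cong fromℤ (ℤ.pos-* m n) ⟨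
      (m ℕ.* n) · 1#          ≈⟨ ×1-homo-* m n ⟩
      m · 1# * n · 1#         ∎
    fromℤ-pos-* m -[1+ n ] = begin
      fromℤ (+ m ℤ.* -[1+ n ])        ≡⟨ cong fromℤ (ℤ.neg-distribʳ-* (+ m) (+ suc n)) ⟨
      fromℤ (ℤ.- (+ m ℤ.* + suc n))   ≈⟨ fromℤ-neg (+ m ℤ.* + suc n) ⟩
      - fromℤ (+ m ℤ.* + suc n)       ≈⟨ -‿cong (fromℤ-pos-* m (+ suc n)) ⟩
      - (m · 1# * suc n · 1#)         ≈⟨ -‿distribʳ-* _ _ ⟩
      m · 1# * - (suc n · 1#)         ∎

  fromℤ-* : ∀ i j → fromℤ (i ℤ.* j) ≈ fromℤ i * fromℤ j
  fromℤ-* (+ m)    j = fromℤ-pos-* m j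
  fromℤ-* -[1+ m ] j = begin
    fromℤ (-[1+ m ] ℤ.* j)          ≡⟨ cong fromℤ (ℤ.neg-distribˡ-* (+ suc m) j) ⟨
    fromℤ (ℤ.- (+ suc m ℤ.* j))     ≈⟨ fromℤ-neg (+ suc m ℤ.* j) ⟩
    - fromℤ (+ suc m ℤ.* j)         ≈⟨ -‿cong (fromℤ-pos-* (suc m) j) ⟩
    - (suc m · 1# * fromℤ j)        ≈⟨ -‿distribˡ-* _ _ ⟩
    - (suc m · 1#) * fromℤ j        ∎

  fromℤ1≈1 : fromℤ 1ℤ ≈ 1#
  fromℤ1≈1 = +-identityʳ 1#

  private
    -- Equality of reals is not assumed decidable; the ring solver compares coefficients in ℤ and
    -- transports them along `fromℤ`.
    morphism : ℤ.+-*-rawRing -Raw-AlmostCommutative⟶ fromCommutativeRing commutativeRing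
    morphism = record
      { ⟦_⟧    = fromℤ
      ; +-homo = fromℤ-+
      ; *-homo = fromℤ-*
      ; -‿homo = fromℤ-neg
      ; 0-homo = refl
      ; 1-homo = fromℤ1≈1
      }

    _coeff≟_ : ∀ i j → Maybe (fromℤ i ≈ fromℤ j)
    i coeff≟ j = Maybe.map (reflexive ∘ cong fromℤ) (dec⇒maybe (i ℤ.≟ j))

  open RingSolver ℤ.+-*-rawRing (fromCommutativeRing commutativeRing) morphism _coeff≟_
    public using (solve; _:=_; _:+_; _:*_; _:-_; :-_; con)

-- Order, inverses and cancellation in the reals.

module RealLemmas {a ℓ} (ℝ : RealNumbers a ℓ) where

  open RealNumbers ℝ
  open RealProperties ℝ
  open IntegerEmbedding ℝ public
  open CommutativeRing commutativeRing using (ring)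
  open RingProperties ring using (-‿involutive)
  open SetoidReasoning setoid

  <-≤-trans : ∀ {x y z} → x < y → y ≤ z → x < z
  <-≤-trans {z = z} x<y y≤z with <-cotrans x<y z
  ... | inj₁ x<z = x<z
  ... | inj₂ z<y = contradiction z<y y≤z

  0<x⇒-x<0 : ∀ {x} → 0# < x → - x < 0#
  0<x⇒-x<0 {x} 0<x =
    <-resp (+-identityʳ (- x)) (-‿inverseˡ x) (+-monoʳ-< (- x) 0<x)

  0<x+x⇒0<x : ∀ {x} → 0# < x + x → 0# < x
  0<x+x⇒0<x {x} 0<x+x = *-cancelˡ-< (+-pos 0<1 0<1)
    (<-resp (sym (zeroʳ _))
            (sym (trans (distribʳ x 1# 1#) (+-cong (*-identityˡ x) (*-identityˡ x))))
            0<x+x)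

  +-cancelˡ : ∀ x {y z} → x + y ≈ x + z → y ≈ z
  +-cancelˡ x {y} {z} x+y≈x+z = begin
    y               ≈⟨ solve 2 (λ x y → y := :- x :+ (x :+ y)) refl x y ⟩
    - x + (x + y)   ≈⟨ +-congˡ x+y≈x+z ⟩
    - x + (x + z)   ≈⟨ solve 2 (λ x z → :- x :+ (x :+ z) := z) refl x z ⟩
    z               ∎

  inverse-unique : ∀ {x y z} → x * y ≈ 1# → x * z ≈ 1# → y ≈ z
  inverse-unique {x} {y} {z} xy≈1 xz≈1 = begin
    y             ≈⟨ *-identityʳ y ⟨
    y * 1#        ≈⟨ *-congˡ xz≈1 ⟨
    y * (x * z)   ≈⟨ solve 3 (λ x y z → y :* (x :* z) := x :* y :* z) refl x y z ⟩
    x * y * z     ≈⟨ *-congʳ xy≈1 ⟩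
    1# * z        ≈⟨ *-identityˡ z ⟩
    z             ∎

  inverse-pos : ∀ {x y} → x * y ≈ 1# → 0# < x → 0# < y
  inverse-pos xy≈1 0<x =
    <-respʳ-≈ (inverse-unique (x*1/x≈1 _ _) xy≈1) (1/-pos 0<x)

  -- Inverses are unique up to `≈`, so the two apartness proofs may be arbitrary.
  1/-cong : ∀ {x y} → x ≈ y → (x#0 : x # 0#) (y#0 : y # 0#) → 1/ x x#0 ≈ 1/ y y#0
  1/-cong {x} {y} x≈y x#0 y#0 =
    inverse-unique (x*1/x≈1 x x#0) (trans (*-congʳ x≈y) (x*1/x≈1 y y#0))

  1/-injective : ∀ {x y} (x#0 : x # 0#) (y#0 : y # 0#) → 1/ x x#0 ≈ 1/ y y#0 → x ≈ y
  1/-injective {x} {y} x#0 y#0 eq = inverse-unique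
    (trans (*-comm _ x) (x*1/x≈1 x x#0))
    (trans (*-congʳ eq) (trans (*-comm _ y) (x*1/x≈1 y y#0)))

  *-cancelˡ : ∀ {x} → x # 0# → ∀ {y z} → x * y ≈ x * z → y ≈ z
  *-cancelˡ {x} x#0 {y} {z} xy≈xz = begin
    y                      ≈⟨ cancel y ⟩
    1/ x x#0 * (x * y)     ≈⟨ *-congˡ xy≈xz ⟩
    1/ x x#0 * (x * z)     ≈⟨ cancel z ⟨
    z                      ∎
    where
    cancel : ∀ y → y ≈ 1/ x x#0 * (x * y)
    cancel y = begin
      y                    ≈⟨ *-identityˡ y ⟨
      1# * y               ≈⟨ *-congʳ (x*1/x≈1 x x#0) ⟨
      x * 1/ x x#0 * y     ≈⟨ solve 3 (λ x y z → x :* z :* y := z :* (x :* y)) refl x y _ ⟩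
      1/ x x#0 * (x * y)   ∎

  #-congʳ : ∀ {x y} → x ≈ y → x # 0# → y # 0#
  #-congʳ = HeytingProperties.#-congʳ heytingCommutativeRing

  ≈0⇒¬#0 : ∀ {x} → x ≈ 0# → ¬ (x # 0#)
  ≈0⇒¬#0 = #-irrefl

  1≉0 : ¬ (1# ≈ 0#)
  1≉0 1≈0 = <-irrefl (sym 1≈0) 0<1

  1/≉0 : ∀ {x} (x#0 : x # 0#) → ¬ (1/ x x#0 ≈ 0#)
  1/≉0 {x} x#0 eq = 1≉0 (trans (sym (x*1/x≈1 x x#0)) (trans (*-congˡ eq) (zeroʳ x)))

  -- Absolute values.

  ∣∣-cong : ∀ {x y} → x ≈ y → ∣ x ∣ ≈ ∣ y ∣
  -- `∣_∣` is a least upper bound supplied by `complete`; congruence comes from its universal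
  -- property, one inequality at a time.
  ∣∣-cong x≈y = ≤-antisym (half x≈y) (half (sym x≈y))
    where
    half : ∀ {x y} → x ≈ y → ∣ x ∣ ≤ ∣ y ∣
    half {x} {y} x≈y = ⊔-lub x (- x)
      (λ lt → x≤x⊔y y (- y) (<-respʳ-≈ x≈y lt))
      (λ lt → y≤x⊔y y (- y) (<-respʳ-≈ (-‿cong x≈y) lt))

  0<x⇒∣x∣≈x : ∀ {x} → 0# < x → ∣ x ∣ ≈ x
  0<x⇒∣x∣≈x {x} 0<x = ≤-antisym
    (⊔-lub x (- x) (<-irrefl refl) (<-asym (<-trans (0<x⇒-x<0 0<x) 0<x)))
    (x≤x⊔y x (- x))

  x<0⇒∣x∣≈-x : ∀ {x} → x < 0# → ∣ x ∣ ≈ - x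
  x<0⇒∣x∣≈-x {x} x<0 = ≤-antisym
    (⊔-lub x (- x) (<-asym (<-trans x<0 (x<0⇒0<-x x<0))) (<-irrefl refl))
    (y≤x⊔y x (- x))

  -- As `q` is positive, `x` and `y` have the same sign. This cancels the two weight factors lost
  -- when a zero entry is removed.
  ∣∣-inverse : ∀ {q x y} → 0# < q → x # 0# → q * x * y ≈ 1# → q * (∣ x ∣ * ∣ y ∣) ≈ 1#
  ∣∣-inverse {q} {x} {y} 0<q x#0 qxy≈1 with #⇒<⊎> x#0
  ... | inj₂ 0<x = begin
    q * (∣ x ∣ * ∣ y ∣)   ≈⟨ *-congˡ (*-cong (0<x⇒∣x∣≈x 0<x)
                               (0<x⇒∣x∣≈x (inverse-pos qxy≈1 (*-pos 0<q 0<x)))) ⟩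
    q * (x * y)           ≈⟨ *-assoc q x y ⟨
    q * x * y             ≈⟨ qxy≈1 ⟩
    1#                    ∎
  ... | inj₁ x<0 = begin
    q * (∣ x ∣ * ∣ y ∣)   ≈⟨ *-congˡ (*-cong (x<0⇒∣x∣≈-x x<0) (x<0⇒∣x∣≈-x y<0)) ⟩
    q * (- x * - y)       ≈⟨ *-assoc q (- x) (- y) ⟨
    q * - x * - y         ≈⟨ q-x-y≈1 ⟩
    1#                    ∎
    where
    q-x-y≈1 : q * - x * - y ≈ 1#
    q-x-y≈1 = trans
      (solve 3 (λ q x y → q :* :- x :* :- y := q :* x :* y) refl q x y) qxy≈1
    y<0 : y < 0#
    y<0 = <-respˡ-≈ (-‿involutive y)
      (0<x⇒-x<0 (inverse-pos q-x-y≈1 (*-pos 0<q (x<0⇒0<-x x<0))))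

  -- Integers and the threshold 1/2.

  0≤n·1 : ∀ n → 0# ≤ n · 1#
  0≤n·1 zero    0<0   = <-irrefl refl 0<0
  0≤n·1 (suc n) 1+n<0 =
    0≤n·1 n (<-trans (<-respʳ-≈ (+-comm _ _) (x<x+y 0<1)) 1+n<0)

  1≤[1+n]·1 : ∀ n → 1# ≤ suc n · 1#
  1≤[1+n]·1 n 1+n<1 = 0≤n·1 n
    (<-resp (solve 2 (λ x y → :- x :+ (x :+ y) := y) refl 1# (n · 1#)) (-‿inverseˡ 1#)
      (+-monoʳ-< (- 1#) 1+n<1))

  1≤∣fromℤ∣ : ∀ {i} → i ≢ 0ℤ → 1# ≤ fromℤ i ⊎ 1# ≤ - fromℤ i
  1≤∣fromℤ∣ {+ zero}    i≢0 = contradiction ≡.refl i≢0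
  1≤∣fromℤ∣ {+ suc n}   i≢0 = inj₁ (1≤[1+n]·1 n)
  1≤∣fromℤ∣ { -[1+ n ]} i≢0 = inj₂ (1≤[1+n]·1 n ∘ <-respˡ-≈ (-‿involutive _))

  -- |x| > 1/2 and |x| < 1/2, cleared of denominators.
  Big Small : Carrier → Set ℓ
  Big   x = 1# < x + x ⊎ 1# < - x + - x
  Small x = (x + x < 1#) × (- x + - x < 1#)

  Small-0 : Small 0#
  Small-0 = <-respˡ-≈ (sym (+-identityˡ 0#)) 0<1
          , <-respˡ-≈ (solve 0 (con 0ℤ := :- con 0ℤ :+ :- con 0ℤ) refl) 0<1

  Big⇒#0 : ∀ {x} → Big x → x # 0#
  Big⇒#0 (inj₁ 1<x+x) = 0<x⇒x#0 (0<x+x⇒0<x (<-trans 0<1 1<x+x))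
  Big⇒#0 {x} (inj₂ 1<-x-x) = <⇒# (<-respˡ-≈ (-‿involutive x)
    (0<x⇒-x<0 (0<x+x⇒0<x (<-trans 0<1 1<-x-x))))

  private
    1≤x⇒1<x+y+x+y : ∀ {x y} → 1# ≤ x → - y + - y < 1# → 1# < (x + y) + (x + y)
    -- Twice `x + y` is `x` plus `x - (- y + - y)`: the first is at least 1, the second is positive.
    1≤x⇒1<x+y+x+y {x} {y} 1≤x -y-y<1 = <-respʳ-≈
      (solve 2 (λ x y → x :+ (x :- (:- y :+ :- y)) := (x :+ y) :+ (x :+ y)) refl x y)
      (≤-<-trans 1≤x (x<x+y (x<y⇒0<y-x (<-≤-trans -y-y<1 1≤x))))

  -- The modulus of the sum is at least 1 minus that of `x`, hence above 1/2; a negative integer is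
  -- handled by negating both summands.
  Big-fromℤ+ : ∀ {i x} → i ≢ 0ℤ → Small x → Big (fromℤ i + x)
  Big-fromℤ+ {i} {x} i≢0 (x+x<1 , -x-x<1) with 1≤∣fromℤ∣ i≢0
  ... | inj₁ 1≤i  = inj₁ (1≤x⇒1<x+y+x+y 1≤i -x-x<1)
  ... | inj₂ 1≤-i = inj₂ (<-respʳ-≈
    (solve 2 (λ i x → (:- i :+ :- x) :+ (:- i :+ :- x) := :- (i :+ x) :+ :- (i :+ x))
      refl (fromℤ i) x)
    (1≤x⇒1<x+y+x+y 1≤-i
      (<-respˡ-≈ (solve 1 (λ x → x :+ x := :- :- x :+ :- :- x) refl x) x+x<1)))

  private
    1≤i⇒i+x≉y : ∀ {i x y} → 1# ≤ i → - x + - x < 1# → y + y < 1# → ¬ (i + x ≈ y)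
    1≤i⇒i+x≉y 1≤i -x-x<1 y+y<1 eq = <-asym y+y<1
      (<-respʳ-≈ (+-cong eq eq) (1≤x⇒1<x+y+x+y 1≤i -x-x<1))

  -- Otherwise the nonzero integer `i - j` has modulus at least 1, and adding the small `x` to it
  -- cannot give the small `y`.
  integer-part-unique : ∀ {i j x y} → Small x → Small y →
                        fromℤ i + x ≈ fromℤ j + y → i ≡ j
  integer-part-unique {i} {j} {x} {y} (x+x<1 , -x-x<1) (y+y<1 , -y-y<1) eq =
    decidable-stable (i ℤ.≟ j) λ i≢j →
      [ (λ 1≤d  → 1≤i⇒i+x≉y 1≤d -x-x<1 y+y<1 d+x≈y)
      -- For `i - j` at most -1 the roles are exchanged: `j - i` plus `y` is `x`.
      , (λ 1≤-d → 1≤i⇒i+x≉y 1≤-d -y-y<1 x+x<1 (trans (+-congˡ (sym d+x≈y))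
          (solve 2 (λ d x → :- d :+ (d :+ x) := x) refl (fromℤ (i ℤ.- j)) x)))
      ]′ (1≤∣fromℤ∣ (i≢j ∘ ℤ.i-j≡0⇒i≡j i j))
    where
    d+x≈y : fromℤ (i ℤ.- j) + x ≈ y
    d+x≈y = begin
      fromℤ (i ℤ.- j) + x          ≈⟨ +-congʳ (fromℤ-+ i (ℤ.- j)) ⟩
      fromℤ i + fromℤ (ℤ.- j) + x  ≈⟨ +-congʳ (+-congˡ (fromℤ-neg j)) ⟩
      fromℤ i - fromℤ j + x        ≈⟨ solve 3 (λ i j x → i :- j :+ x := :- j :+ (i :+ x))
                                        refl (fromℤ i) (fromℤ j) x ⟩
      - fromℤ j + (fromℤ i + x)    ≈⟨ +-congˡ eq ⟩
      - fromℤ j + (fromℤ j + y)    ≈⟨ solve 2 (λ j y → :- j :+ (j :+ y) := y)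
                                        refl (fromℤ j) y ⟩
      y                            ∎

  private
    Small-inverse⁺ : ∀ {q d e} → 0# < q → fromℤ (+ 4) ≤ q → q * d * e ≈ 1# →
                     1# < d + d → Small e
    Small-inverse⁺ {q} {d} {e} 0<q 4≤q qde≈1 1<d+d = e+e<1 , -e-e<1
      where
      0<e : 0# < e
      0<e = inverse-pos qde≈1 (*-pos 0<q (0<x+x⇒0<x (<-trans 0<1 1<d+d)))
      0<q[e+e] : 0# < q * (e + e)
      0<q[e+e] = *-pos 0<q (+-pos 0<e 0<e)
      [d+d]q[e+e]≈4 : (d + d) * (q * (e + e)) ≈ fromℤ (+ 4)
      [d+d]q[e+e]≈4 = begin
        (d + d) * (q * (e + e))      ≈⟨ solve 3 (λ d q e →
                                          (d :+ d) :* (q :* (e :+ e))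
                                            := con (+ 4) :* (q :* d :* e)) refl d q e ⟩
        fromℤ (+ 4) * (q * d * e)    ≈⟨ *-congˡ qde≈1 ⟩
        fromℤ (+ 4) * 1#             ≈⟨ *-identityʳ _ ⟩
        fromℤ (+ 4)                  ∎
      e+e<1 : e + e < 1#
      -- From 1 < 2d follows q · 2e < 2d · q · 2e = 4 ≤ q, and `q` cancels; the bound 4 enters here.
      e+e<1 = *-cancelˡ-< 0<q (<-≤-trans
        (<-resp (*-identityˡ _) [d+d]q[e+e]≈4 (*-monoˡ-< 0<q[e+e] 1<d+d))
        (4≤q ∘ <-respˡ-≈ (*-identityʳ q)))
      -e-e<1 : - e + - e < 1#
      -e-e<1 = <-trans (<-respˡ-≈ (solve 1 (λ e → :- (e :+ e) := :- e :+ :- e) refl e)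
        (0<x⇒-x<0 (+-pos 0<e 0<e))) 0<1

  -- For negative `d` the positive case applies to `- d` and `- e`, and the two halves of `Small`
  -- swap.
  Small-inverse : ∀ {q d e} → 0# < q → fromℤ (+ 4) ≤ q → q * d * e ≈ 1# →
                  Big d → Small e
  Small-inverse 0<q 4≤q qde≈1 (inj₁ 1<d+d) = Small-inverse⁺ 0<q 4≤q qde≈1 1<d+d
  Small-inverse {q} {d} {e} 0<q 4≤q qde≈1 (inj₂ 1<-d-d) =
    <-respˡ-≈ (+-cong (-‿involutive e) (-‿involutive e)) (proj₂ small-[-e]) , proj₁ small-[-e]
    where
    small-[-e] : Small (- e)
    small-[-e] = Small-inverse⁺ 0<q 4≤q (trans
      (solve 3 (λ q d e → q :* :- d :* :- e := q :* d :* e) refl q d e) qde≈1) 1<-d-d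

-- Polynomial functions with integer coefficients.

module IntegerPolynomials {a ℓ} (ℝ : RealNumbers a ℓ) where

  open RealNumbers ℝ
  open RealProperties ℝ
  open RealLemmas ℝ
  open SetoidReasoning setoid

  private
    _⊞_ : List ℤ → List ℤ → List ℤ
    []      ⊞ r       = r
    (i ∷ p) ⊞ []      = i ∷ p
    (i ∷ p) ⊞ (j ∷ r) = (i ℤ.+ j) ∷ (p ⊞ r)

    _⊡_ : ℤ → List ℤ → List ℤ
    i ⊡ []      = []
    i ⊡ (j ∷ p) = (i ℤ.* j) ∷ (i ⊡ p)

    _⊠_ : List ℤ → List ℤ → List ℤ
    []      ⊠ r = []
    (i ∷ p) ⊠ r = (i ⊡ r) ⊞ (0ℤ ∷ (p ⊠ r))

    eval-⊞ : ∀ p r x → eval (p ⊞ r) x ≈ eval p x + eval r x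
    eval-⊞ []      r       x = sym (+-identityˡ _)
    eval-⊞ (i ∷ p) []      x = sym (+-identityʳ _)
    eval-⊞ (i ∷ p) (j ∷ r) x = begin
      fromℤ (i ℤ.+ j) + x * eval (p ⊞ r) x
        ≈⟨ +-cong (fromℤ-+ i j) (*-congˡ (eval-⊞ p r x)) ⟩
      fromℤ i + fromℤ j + x * (eval p x + eval r x)
        ≈⟨ solve 5 (λ i j x p r → i :+ j :+ x :* (p :+ r)
                      := i :+ x :* p :+ (j :+ x :* r)) refl
             (fromℤ i) (fromℤ j) x (eval p x) (eval r x) ⟩
      fromℤ i + x * eval p x + (fromℤ j + x * eval r x) ∎

    eval-⊡ : ∀ i p x → eval (i ⊡ p) x ≈ fromℤ i * eval p x
    eval-⊡ i []      x = sym (zeroʳ _)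
    eval-⊡ i (j ∷ p) x = begin
      fromℤ (i ℤ.* j) + x * eval (i ⊡ p) x
        ≈⟨ +-cong (fromℤ-* i j) (*-congˡ (eval-⊡ i p x)) ⟩
      fromℤ i * fromℤ j + x * (fromℤ i * eval p x)
        ≈⟨ solve 4 (λ i j x p → i :* j :+ x :* (i :* p) := i :* (j :+ x :* p)) refl
             (fromℤ i) (fromℤ j) x (eval p x) ⟩
      fromℤ i * (fromℤ j + x * eval p x) ∎

    eval-⊠ : ∀ p r x → eval (p ⊠ r) x ≈ eval p x * eval r x
    eval-⊠ []      r x = sym (zeroˡ _)
    eval-⊠ (i ∷ p) r x = begin
      eval ((i ⊡ r) ⊞ (0ℤ ∷ (p ⊠ r))) x
        ≈⟨ eval-⊞ (i ⊡ r) (0ℤ ∷ (p ⊠ r)) x ⟩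
      eval (i ⊡ r) x + (0# + x * eval (p ⊠ r) x)
        ≈⟨ +-cong (eval-⊡ i r x) (+-congˡ (*-congˡ (eval-⊠ p r x))) ⟩
      fromℤ i * eval r x + (0# + x * (eval p x * eval r x))
        ≈⟨ solve 4 (λ i x p r → i :* r :+ (con 0ℤ :+ x :* (p :* r))
                      := (i :+ x :* p) :* r) refl
             (fromℤ i) x (eval p x) (eval r x) ⟩
      (fromℤ i + x * eval p x) * eval r x ∎

    eval-zero : ∀ p → ¬ Any (_≢ 0ℤ) p → ∀ x → eval p x ≈ 0#
    eval-zero []      _   x = refl
    eval-zero (i ∷ p) p≡0 x = begin
      fromℤ i + x * eval p x  ≈⟨ +-cong
                                   (reflexive (cong fromℤ
                                     (decidable-stable (i ℤ.≟ 0ℤ) (p≡0 ∘ here))))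
                                   (*-congˡ (eval-zero p (p≡0 ∘ there) x)) ⟩
      0# + x * 0#             ≈⟨ +-identityˡ _ ⟩
      x * 0#                  ≈⟨ zeroʳ x ⟩
      0#                      ∎

  -- Agreement is demanded at every real, so that an identity found at `q` can be carried to another
  -- argument.
  IsPolynomial : (Carrier → Carrier) → Set (a Level.⊔ ℓ)
  IsPolynomial f = ∃[ p ] ∀ x → f x ≈ eval p x

  const-polynomial : ∀ i → IsPolynomial (λ _ → fromℤ i)
  const-polynomial i = i ∷ [] ,
    λ x → sym (trans (+-congˡ (zeroʳ x)) (+-identityʳ _))

  id-polynomial : IsPolynomial (λ x → x)
  id-polynomial = 0ℤ ∷ 1ℤ ∷ [] , λ x →
    solve 1 (λ x → x := con 0ℤ :+ x :* (con 1ℤ :+ x :* con 0ℤ)) refl x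

  +-polynomial : ∀ {f g} → IsPolynomial f → IsPolynomial g → IsPolynomial (λ x → f x + g x)
  +-polynomial (p , f≈p) (r , g≈r) =
    p ⊞ r , λ x → trans (+-cong (f≈p x) (g≈r x)) (sym (eval-⊞ p r x))

  *-polynomial : ∀ {f g} → IsPolynomial f → IsPolynomial g → IsPolynomial (λ x → f x * g x)
  *-polynomial (p , f≈p) (r , g≈r) =
    p ⊠ r , λ x → trans (*-cong (f≈p x) (g≈r x)) (sym (eval-⊠ p r x))

  -- Integer coefficients can be tested for zero: a nonzero one would make `q` algebraic, and if all
  -- vanish then so does `f`.
  transcendental-zero : ∀ {q f} → Transcendental q → IsPolynomial f → f q ≈ 0# →
                        ∀ x → f x ≈ 0#
  transcendental-zero {q} transcendental (p , f≈p) fq≈0 x with any? (λ i → ¬? (i ℤ.≟ 0ℤ)) p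
  ... | yes p≢0 = contradiction (p , p≢0 , trans (sym (f≈p q)) fq≈0) transcendental
  ... | no  p≡0 = trans (f≈p x) (eval-zero p p≡0 x)

  transcendental-≈ : ∀ {q f g} → Transcendental q → IsPolynomial f → IsPolynomial g →
                     f q ≈ g q → ∀ x → f x ≈ g x
  transcendental-≈ {q} {f} {g} transcendental f-poly g-poly fq≈gq x = begin
    f x                                ≈⟨ split (f x) (g x) ⟩
    g x + (f x + fromℤ -1ℤ * g x)      ≈⟨ +-congˡ (transcendental-zero transcendental
                                            (+-polynomial f-poly
                                              (*-polynomial (const-polynomial -1ℤ) g-poly))
                                            fq-gq≈0 x) ⟩
    g x + 0#                           ≈⟨ +-identityʳ (g x) ⟩
    g x                                ∎
    where
    split : ∀ y z → y ≈ z + (y + fromℤ -1ℤ * z)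
    split = solve 2 (λ y z → y := z :+ (y :+ con -1ℤ :* z)) refl
    fq-gq≈0 : f q + fromℤ -1ℤ * g q ≈ 0#
    fq-gq≈0 = trans (+-congʳ fq≈gq)
      (solve 1 (λ z → z :+ con -1ℤ :* z := con 0ℤ) refl (g q))

-- Values of paths as fractions of integer polynomials.

module Continuants {a ℓ} (ℝ : RealNumbers a ℓ) where

  open RealNumbers ℝ
  open RealProperties ℝ
  open RealLemmas ℝ
  open IntegerPolynomials ℝ

  -- c(x,m) = numerator m x / denominator m x.
  mutual

    numerator : ∀ {k} → Vec ℤ (suc k) → Carrier → Carrier
    numerator {zero}  m x = fromℤ (last m)
    numerator {suc k} m x = fromℤ (last m) * denominator m x + denominator (init m) x

    denominator : ∀ {k} → Vec ℤ (suc k) → Carrier → Carrier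
    denominator {zero}  m x = 1#
    denominator {suc k} m x = x * numerator (init m) x

  mutual

    numerator-polynomial : ∀ {k} (m : Vec ℤ (suc k)) → IsPolynomial (numerator m)
    numerator-polynomial {zero}  m = const-polynomial (last m)
    numerator-polynomial {suc k} m = +-polynomial
      (*-polynomial (const-polynomial (last m)) (denominator-polynomial m))
      (denominator-polynomial (init m))

    denominator-polynomial : ∀ {k} (m : Vec ℤ (suc k)) → IsPolynomial (denominator m)
    denominator-polynomial {zero}  m = 1ℤ ∷ [] , λ x →
      trans (sym fromℤ1≈1) (proj₂ (const-polynomial 1ℤ) x)
    denominator-polynomial {suc k} m = *-polynomial id-polynomial (numerator-polynomial (init m))

-- Values and weights of paths.

module PathLemmas {a ℓ} (ℝ : RealNumbers a ℓ)
                  (q : RealNumbers.Carrier ℝ)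
                  (0<q : RealNumbers._<_ ℝ (RealNumbers.0# ℝ) q) where

  open RealNumbers ℝ
  open RealProperties ℝ
  open RealLemmas ℝ
  open Paths ℝ q 0<q
  open Continuants ℝ
  open SetoidReasoning setoid

  private
    w-append : ∀ s t p c → s * t * (p * c) ≈ s * (t * p * c)
    w-append = solve 4 (λ s t p c → s :* t :* (p :* c) := s :* (t :* p :* c)) refl

    w-merge : ∀ s t p d x → s * s * (d * x) * (t * p) ≈ s * (s * t * (p * d) * x)
    w-merge = solve 5 (λ s t p d x →
      s :* s :* (d :* x) :* (t :* p) := s :* (s :* t :* (p :* d) :* x)) refl

    *-rearrange : ∀ e q d y → e * (q * (d * y)) ≈ q * d * e * y
    *-rearrange = solve 4 (λ e q d y → e :* (q :* (d :* y)) := q :* d :* e :* y) refl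

    *-swap : ∀ x y z → x * y * z ≈ x * z * y
    *-swap = solve 3 (λ x y z → x :* y :* z := x :* z :* y) refl

  qc#0 : ∀ {x} → x # 0# → q * x # 0#
  qc#0 = x#0y#0→xy#0 (0<x⇒x#0 0<q)

  -- The value minus its last entry; the default 0 keeps `c≈last+tail` true at length 0.
  tail : ∀ {k} (m : Vec ℤ (suc k)) → IsPath m → Carrier
  tail {zero}  m _            = 0#
  tail {suc k} m (path , c#0) = 1/ (q * c (init m) path) (qc#0 c#0)

  c≈last+tail : ∀ {k} (m : Vec ℤ (suc k)) (path : IsPath m) →
                c m path ≈ fromℤ (last m) + tail m path
  c≈last+tail {zero}  m _ = sym (+-identityʳ _)
  c≈last+tail {suc k} m _ = refl

  -- A path carries apartness proofs, which need not be unique; they enter the value only through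
  -- inverses.
  c-irrelevant : ∀ {k} (m : Vec ℤ (suc k)) (p p′ : IsPath m) → c m p ≈ c m p′
  c-irrelevant {zero}  m _ _ = refl
  c-irrelevant {suc k} m (p , c#0) (p′ , c#0′) =
    +-congˡ (1/-cong (*-congˡ (c-irrelevant (init m) p p′)) (qc#0 c#0) (qc#0 c#0′))

  ∏-irrelevant : ∀ {k} (m : Vec ℤ (suc k)) (p p′ : IsPath m) → ∏∣c∣ m p ≈ ∏∣c∣ m p′
  ∏-irrelevant {zero}  m _ _ = refl
  ∏-irrelevant {suc k} m (p , _) (p′ , _) =
    *-cong (∏-irrelevant (init m) p p′) (∣∣-cong (c-irrelevant (init m) p p′))

  w-irrelevant : ∀ {k} (m : Vec ℤ (suc k)) (p p′ : IsPath m) → w m p ≈ w m p′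
  w-irrelevant m p p′ = *-congˡ (∏-irrelevant m p p′)

  -- The length belongs to the claim, so equality is between pairs; the path proofs are left out of
  -- it.
  AtMostOneProperPath : Set ℓ
  AtMostOneProperPath = ∀ {k l} (m : Vec ℤ (suc k)) (n : Vec ℤ (suc l))
    (path-m : IsPath m) (path-n : IsPath n) → Proper m → Proper n →
    c m path-m ≈ c n path-n → _≡_ {A = ∃ λ j → Vec ℤ (suc j)} (k , m) (l , n)

  -- The case q ≥ 4.

  module Large (4≤q : fromℤ (+ 4) ≤ q) where

    mutual

      -- The preceding value ends in a nonzero entry, so it exceeds 1/2 in modulus; as q ≥ 4, the
      -- reciprocal of `q` times it is below 1/2.
      Small-tail : ∀ {k} (m : Vec ℤ (suc k)) (path : IsPath m) → Proper m →
                   Small (tail m path)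
      Small-tail {zero}  m _ _ = Small-0
      Small-tail {suc k} m (path , _) proper = Small-inverse 0<q 4≤q (x*1/x≈1 _ _)
        (Big-c (init m) path (All-init (init m) proper) (All-last (init m) proper))

      -- `Proper` leaves the last entry free, hence the separate assumption: a nonzero integer plus
      -- a small tail stays above 1/2 in modulus.
      Big-c : ∀ {k} (m : Vec ℤ (suc k)) (path : IsPath m) → Proper m → last m ≢ 0ℤ →
              Big (c m path)
      Big-c m path proper last≢0 = Big-resp (sym (c≈last+tail m path))
        (Big-fromℤ+ last≢0 (Small-tail m path proper))
        where
        Big-resp : ∀ {x y} → x ≈ y → Big x → Big y
        Big-resp x≈y (inj₁ 1<x+x)  = inj₁ (<-respʳ-≈ (+-cong x≈y x≈y) 1<x+x)
        Big-resp x≈y (inj₂ 1<-x-x) =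
          inj₂ (<-respʳ-≈ (+-cong (-‿cong x≈y) (-‿cong x≈y)) 1<-x-x)

    -- The denominators exceed 1/2 in modulus, so they are apart from zero. This later makes proper
    -- vectors into paths for 4.
    proper⇒path : ∀ {k} (m : Vec ℤ (suc k)) → Proper m → IsPath m
    proper⇒path {zero}  m _      = _
    proper⇒path {suc k} m proper = path ,
      Big⇒#0 (Big-c (init m) path (All-init (init m) proper) (All-last (init m) proper))
      where path = proper⇒path (init m) (All-init (init m) proper)

    -- Small tails force equal last entries; cancelling these equates the tails, hence the preceding
    -- values, and both vectors lose an entry.
    atMostOneProperPath : AtMostOneProperPath
    atMostOneProperPath {k} {l} m n path-m path-n proper-m proper-n c≈c =
      descend m n path-m path-n proper-m proper-n last≡last
        (+-cancelˡ (fromℤ (last m)) (trans last+tail≈last+tail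
          (+-congʳ (reflexive (cong fromℤ (≡.sym last≡last))))))
      where
      last+tail≈last+tail :
        fromℤ (last m) + tail m path-m ≈ fromℤ (last n) + tail n path-n
      last+tail≈last+tail =
        trans (sym (c≈last+tail m path-m)) (trans c≈c (c≈last+tail n path-n))
      last≡last : last m ≡ last n
      last≡last = integer-part-unique
        (Small-tail m path-m proper-m) (Small-tail n path-n proper-n) last+tail≈last+tail
      descend : ∀ {k l} (m : Vec ℤ (suc k)) (n : Vec ℤ (suc l))
        (path-m : IsPath m) (path-n : IsPath n) → Proper m → Proper n →
        last m ≡ last n → tail m path-m ≈ tail n path-n →
        _≡_ {A = ∃ λ j → Vec ℤ (suc j)} (k , m) (l , n)
      descend {zero} {zero} (x ∷ []) (.x ∷ []) _ _ _ _ ≡.refl _ = ≡.refl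
      -- Lengths cannot differ: an empty tail is 0, whereas a reciprocal never is.
      descend {zero} {suc l} m n _ _ _ _ _ tail≈tail =
        contradiction (sym tail≈tail) (1/≉0 _)
      descend {suc k} {zero} m n _ _ _ _ _ tail≈tail =
        contradiction tail≈tail (1/≉0 _)
      descend {suc k} {suc l} m n (path-m , _) (path-n , _) proper-m proper-n last≡ tail≈ =
        initLast-injective (cong (λ (j , v) → suc j , v)
          (atMostOneProperPath (init m) (init n) path-m path-n
            (All-init (init m) proper-m) (All-init (init n) proper-n)
            (*-cancelˡ (0<x⇒x#0 0<q) (1/-injective _ _ tail≈)))) last≡

  -- Replacing a path by a proper one of the same value and weight.

  ProperPathWith : (value weight : Carrier) → Set ℓ
  ProperPathWith x y = ∃[ k ] ∃ λ (m : Vec ℤ (suc k)) → ∃ λ (path : IsPath m) →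
    Proper m × c m path ≈ x × w m path ≈ y

  append : ∀ {k} (m : Vec ℤ (suc k)) (path : IsPath m) → Proper m → last m ≢ 0ℤ →
    (c#0 : c m path # 0#) (i : ℤ) →
    ProperPathWith (fromℤ i + 1/ (q * c m path) (qc#0 c#0))
                   (√ q 0<q * (w m path * ∣ c m path ∣))
  append {k} m path proper last≢0 c#0 i =
    let m′ , init≡ , last≡ = snoc m i in build m′ m init≡ last≡ path proper last≢0 c#0
    where
    -- `m` is generalised to a fresh variable, so that matching with `refl` can turn it into
    -- `init m′`.
    build : (m′ : Vec ℤ (suc (suc k))) (m : Vec ℤ (suc k)) → init m′ ≡ m → last m′ ≡ i →
      (path : IsPath m) → Proper m → last m ≢ 0ℤ → (c#0 : c m path # 0#) →
      ProperPathWith (fromℤ i + 1/ (q * c m path) (qc#0 c#0))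
                     (√ q 0<q * (w m path * ∣ c m path ∣))
    build m′ m ≡.refl ≡.refl path proper last≢0 c#0 =
      suc k , m′ , (path , c#0) , All-init-last m proper last≢0 , refl ,
      w-append (√ q 0<q) (√ q 0<q ^ k) (∏∣c∣ m path) ∣ c m path ∣

  -- Properness does not constrain the last entry, and the last value is no factor of the weight.
  shift : ∀ {k} (m : Vec ℤ (suc k)) (path : IsPath m) → Proper m → (i : ℤ) →
          ProperPathWith (fromℤ i + c m path) (w m path)
  shift {zero} m path proper i =
    0 , i ℤ.+ last m ∷ [] , path , [] , fromℤ-+ i (last m) , refl
  shift {suc k} m (path , c#0) proper i =
    let m′ , init≡ , last≡ = snoc (init m) (i ℤ.+ last m)
    in build m′ (init m) init≡ last≡ path proper c#0
    where
    build : (m′ : Vec ℤ (suc (suc k))) (u : Vec ℤ (suc k)) →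
      init m′ ≡ u → last m′ ≡ i ℤ.+ last m →
      (path : IsPath u) → All (_≢ 0ℤ) u → (c#0 : c u path # 0#) →
      ProperPathWith (fromℤ i + (fromℤ (last m) + 1/ (q * c u path) (qc#0 c#0)))
                     ((√ q 0<q ^ suc k) * (∏∣c∣ u path * ∣ c u path ∣))
    build m′ u ≡.refl last≡ path proper c#0 = suc k , m′ , (path , c#0) , proper ,
      trans (+-congʳ (trans (reflexive (cong fromℤ last≡)) (fromℤ-+ i (last m))))
            (+-assoc _ _ _) ,
      refl

  ProperPathWith-resp : ∀ {x x′ y y′} → x ≈ x′ → y ≈ y′ →
                        ProperPathWith x y → ProperPathWith x′ y′
  ProperPathWith-resp x≈x′ y≈y′ (k , m , path , proper , c≈x , w≈y) =
    k , m , path , proper , trans c≈x x≈x′ , trans w≈y y≈y′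

  -- If the last entry is 0 then q d x = 1 for the preceding value d, so that
  -- 1/(q x) = d and i can be absorbed into the entry before the zero.
  mergeZero : ∀ {k x y} (x#0 : x # 0#) (i : ℤ) (m : Vec ℤ (suc k)) (path : IsPath m) →
    Proper m → c m path ≈ x → w m path ≈ y → last m ≡ 0ℤ →
    ProperPathWith (fromℤ i + 1/ (q * x) (qc#0 x#0)) (√ q 0<q * (y * ∣ x ∣))
  -- A single entry 0 has value 0, contradicting `x # 0`.
  mergeZero {zero} x#0 i m _ _ c≈x _ last≡0 =
    contradiction x#0 (≈0⇒¬#0 (trans (sym c≈x) (reflexive (cong fromℤ last≡0))))
  mergeZero {suc k} {x} {y} x#0 i m (path , c#0) proper c≈x w≈y last≡0 =
    ProperPathWith-resp
      (+-congˡ (inverse-unique (trans (*-swap q x d) qdx≈1) (x*1/x≈1 (q * x) (qc#0 x#0))))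
      (begin
        t * p                             ≈⟨ *-identityˡ (t * p) ⟨
        1# * (t * p)                      ≈⟨ *-congʳ (∣∣-inverse 0<q c#0 qdx≈1) ⟨
        -- `q` splits into two square roots, one for each missing weight factor.
        q * (∣ d ∣ * ∣ x ∣) * (t * p)     ≈⟨ *-congʳ (*-congʳ (√*√≈q q 0<q)) ⟨
        s * s * (∣ d ∣ * ∣ x ∣) * (t * p) ≈⟨ w-merge s t p ∣ d ∣ ∣ x ∣ ⟩
        s * (s * t * (p * ∣ d ∣) * ∣ x ∣) ≈⟨ *-congˡ (*-congʳ w≈y) ⟩
        s * (y * ∣ x ∣)                   ∎)
      (shift (init m) path (All-init (init m) proper) i)
    where
    d = c (init m) path
    s = √ q 0<q
    t = s ^ k
    p = ∏∣c∣ (init m) path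
    qdx≈1 : q * d * x ≈ 1#
    qdx≈1 = begin
      q * d * x                               ≈⟨ *-congˡ c≈x ⟨
      q * d * (fromℤ (last m) + 1/ (q * d) _) ≈⟨ *-congˡ (+-congʳ
                                                   (reflexive (cong fromℤ last≡0))) ⟩
      q * d * (0# + 1/ (q * d) _)             ≈⟨ *-congˡ (+-identityˡ _) ⟩
      q * d * 1/ (q * d) _                    ≈⟨ x*1/x≈1 (q * d) (qc#0 c#0) ⟩
      1#                                      ∎

  -- A vanishing last entry would become a forbidden interior zero and is merged away; otherwise the
  -- new entry is appended.
  extend : ∀ {x y} (x#0 : x # 0#) (i : ℤ) → ProperPathWith x y →
    ProperPathWith (fromℤ i + 1/ (q * x) (qc#0 x#0)) (√ q 0<q * (y * ∣ x ∣))
  extend {x} {y} x#0 i (k , m , path , proper , c≈x , w≈y) = helper (last m ℤ.≟ 0ℤ)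
    where
    helper : Dec (last m ≡ 0ℤ) →
      ProperPathWith (fromℤ i + 1/ (q * x) (qc#0 x#0)) (√ q 0<q * (y * ∣ x ∣))
    helper (yes last≡0) = mergeZero x#0 i m path proper c≈x w≈y last≡0
    helper (no last≢0)  = ProperPathWith-resp
      (+-congˡ (1/-cong (*-congˡ c≈x) (qc#0 c#0) (qc#0 x#0)))
      (*-congˡ (*-cong w≈y (∣∣-cong c≈x)))
      (append m path proper last≢0 c#0 i)
      where
      c#0 : c m path # 0#
      c#0 = #-congʳ (sym c≈x) x#0

  -- By induction the prefix is first replaced by a proper path; the last entry is then attached.
  toProper : ∀ {k} (m : Vec ℤ (suc k)) (path : IsPath m) →
             ProperPathWith (c m path) (w m path)
  toProper {zero}  m path = 0 , m , path , All-empty (init m) , refl , refl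
  toProper {suc k} m (path , c#0) = ProperPathWith-resp refl
    (sym (w-append (√ q 0<q) (√ q 0<q ^ k) (∏∣c∣ (init m) path) ∣ c (init m) path ∣))
    (extend c#0 (last m) (toProper (init m) path))

  -- The proper replacements share a value, hence coincide, and replacement keeps the weight.
  atMostOneProperPath⇒uniqueWeight : AtMostOneProperPath → UniqueWeight
  atMostOneProperPath⇒uniqueWeight unique m n path-m path-n c≈c =
    let k , m′ , path-m′ , proper-m′ , c-m′≈ , w-m′≈ = toProper m path-m
        l , n′ , path-n′ , proper-n′ , c-n′≈ , w-n′≈ = toProper n path-n
    in trans (sym w-m′≈) (trans
         (w-cong path-m′ path-n′ (unique m′ n′ path-m′ path-n′ proper-m′ proper-n′
           (trans c-m′≈ (trans c≈c (sym c-n′≈)))))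
         w-n′≈)
    where
    w-cong : ∀ {k l} {m : Vec ℤ (suc k)} {n : Vec ℤ (suc l)}
      (path-m : IsPath m) (path-n : IsPath n) →
      _≡_ {A = ∃ λ j → Vec ℤ (suc j)} (k , m) (l , n) → w m path-m ≈ w n path-n
    w-cong {m = m} path-m path-n ≡.refl = w-irrelevant m path-m path-n

  -- Equality of values as a polynomial identity.

  mutual

    -- This is `q` times the preceding value times the preceding denominator, all apart from zero.
    denominator#0 : ∀ {k} (m : Vec ℤ (suc k)) → IsPath m → denominator m q # 0#
    denominator#0 {zero}  m _ = HeytingProperties.1#0 heytingCommutativeRing
    denominator#0 {suc k} m (path , c#0) = qc#0
      (#-congʳ (c*denominator≈numerator (init m) path)
        (x#0y#0→xy#0 c#0 (denominator#0 (init m) path)))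

    c*denominator≈numerator : ∀ {k} (m : Vec ℤ (suc k)) (path : IsPath m) →
      c m path * denominator m q ≈ numerator m q
    c*denominator≈numerator {zero}  m _ = *-identityʳ _
    c*denominator≈numerator {suc k} m (path , c#0) = begin
      (i + e) * (q * numerator (init m) q)    ≈⟨ distribʳ _ i e ⟩
      i * D + e * (q * numerator (init m) q)  ≈⟨ +-congˡ (*-congˡ (*-congˡ
                                                   (c*denominator≈numerator (init m) path))) ⟨
      i * D + e * (q * (d * D′))              ≈⟨ +-congˡ (*-rearrange e q d D′) ⟩
      i * D + q * d * e * D′                  ≈⟨ +-congˡ (*-congʳ (x*1/x≈1 (q * d) _)) ⟩
      i * D + 1# * D′                         ≈⟨ +-congˡ (*-identityˡ D′) ⟩
      i * D + D′                              ∎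
      where
      i  = fromℤ (last m)
      d  = c (init m) path
      e  = 1/ (q * d) (qc#0 c#0)
      D  = denominator m q
      D′ = denominator (init m) q

  -- Equality of fractions cleared of denominators: both sides are polynomial in `x`, and `x` need
  -- not be `q`.
  CrossEqual : ∀ {k l} → Vec ℤ (suc k) → Vec ℤ (suc l) → Carrier → Set ℓ
  CrossEqual m n x = numerator m x * denominator n x ≈ numerator n x * denominator m x

  module _ {k l} (m : Vec ℤ (suc k)) (n : Vec ℤ (suc l))
           (path-m : IsPath m) (path-n : IsPath n) where

    private
      D = denominator m q
      E = denominator n q
      N≈ : numerator m q * E ≈ D * E * c m path-m
      N≈ = trans (*-congʳ (sym (c*denominator≈numerator m path-m)))
        (solve 3 (λ x D E → x :* D :* E := D :* E :* x) refl (c m path-m) D E)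
      M≈ : numerator n q * D ≈ D * E * c n path-n
      M≈ = trans (*-congʳ (sym (c*denominator≈numerator n path-n)))
        (solve 3 (λ x D E → x :* E :* D := D :* E :* x) refl (c n path-n) D E)

    c≈c⇒crossEqual : c m path-m ≈ c n path-n → CrossEqual m n q
    c≈c⇒crossEqual c≈c = trans N≈ (trans (*-congˡ c≈c) (sym M≈))

    crossEqual⇒c≈c : CrossEqual m n q → c m path-m ≈ c n path-n
    crossEqual⇒c≈c eq = *-cancelˡ
      (x#0y#0→xy#0 (denominator#0 m path-m) (denominator#0 n path-n))
      (trans (sym N≈) (trans eq M≈))

-- Transfer from a transcendental q to 4.

module Uniqueness {a ℓ} (ℝ : RealNumbers a ℓ)
                  (q : RealNumbers.Carrier ℝ)
                  (0<q : RealNumbers._<_ ℝ (RealNumbers.0# ℝ) q) where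

  open RealNumbers ℝ
  open RealProperties ℝ
  open RealLemmas ℝ
  open IntegerPolynomials ℝ
  open Continuants ℝ
  open PathLemmas ℝ q 0<q

  private
    0<4 : 0# < fromℤ (+ 4)
    0<4 = <-≤-trans 0<1 (1≤[1+n]·1 3)

    module Path₄ = PathLemmas ℝ (fromℤ (+ 4)) 0<4
    module Large₄ = Path₄.Large (<-irrefl refl)

  -- `Proper` does not mention `q`, so the same vectors are paths for 4. The cross-multiplied
  -- equality then holds at every argument, and at 4 it turns back into an equality of values.
  atMostOne-transcendental : Transcendental q → AtMostOneProperPath
  atMostOne-transcendental transcendental m n path-m path-n proper-m proper-n c≈c =
    Large₄.atMostOneProperPath m n path₄-m path₄-n proper-m proper-n
      (Path₄.crossEqual⇒c≈c m n path₄-m path₄-n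
        (transcendental-≈ transcendental
          (*-polynomial (numerator-polynomial m) (denominator-polynomial n))
          (*-polynomial (numerator-polynomial n) (denominator-polynomial m))
          (c≈c⇒crossEqual m n path-m path-n c≈c)
          (fromℤ (+ 4))))
    where
    path₄-m = Large₄.proper⇒path m proper-m
    path₄-n = Large₄.proper⇒path n proper-n

  atMostOne : Transcendental q ⊎ fromℤ (+ 4) ≤ q → AtMostOneProperPath
  atMostOne (inj₁ transcendental) = atMostOne-transcendental transcendental
  atMostOne (inj₂ 4≤q)            = Large.atMostOneProperPath 4≤q

theorem2 : ∀ {a₀ ℓ} (ℝ : RealNumbers a₀ ℓ) →
    let open RealNumbers ℝ
        open RealProperties ℝ
    in
    (q : Carrier) (0<q : 0# < q) →
    Transcendental q ⊎ fromℤ (+ 4) ≤ q →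
    let open Paths ℝ q 0<q in
    ((a : Carrier) → ∀ {k l} (m : Vec ℤ (suc k)) (n : Vec ℤ (suc l)) →
      (path-m : IsPath m) (path-n : IsPath n) → Proper m → Proper n →
      c m path-m ≈ a → c n path-n ≈ a →
      _≡_ {A = ∃ λ j → Vec ℤ (suc j)} (k , m) (l , n))
    × UniqueWeight
theorem2 ℝ q 0<q hyp =
  (λ a m n path-m path-n proper-m proper-n c≈a c′≈a →
    unique m n path-m path-n proper-m proper-n (trans c≈a (sym c′≈a))) ,
  PathLemmas.atMostOneProperPath⇒uniqueWeight ℝ q 0<q unique
  where
  open RealNumbers ℝ using (trans; sym)
  unique : PathLemmas.AtMostOneProperPath ℝ q 0<q
  unique = Uniqueness.atMostOne ℝ q 0<q hyp
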